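{- For every integer $t\ge 5$, $$R^{\mathrm{KG}}_2(3,t)\le 2R(3,t-2)+2t+1.$$
   Context: $R(a,b)$ is the classical Ramsey number: the least $n$ such that every red/blue edge-coloring of $K_n$ contains a red $K_a$ or a blue $K_b$. The Kneser graph $\mathrm{KG}(n,r)$ has vertex set the $r$-element subsets of $[n]=\{1,\dots,n\}$, with two sets adjacent iff they are disjoint. The $r$-Kneser Ramsey number $R^{\mathrm{KG}}_r(a,b)$ is the minimum integer $n$ such that every red/blue edge-coloring of $\mathrm{KG}(n,r)$ contains a red $K_a$ (a set of $a$ pairwise adjacent vertices with all connecting edges red) or a blue $K_b$. -}

module Defs where

open import Data.Nat using (ℕ; _≤_)
open import Data.Bool using (Bool; true; false)
open import Data.Fin using (Fin)
open import Data.Fin.Subset using (Subset; ∣_∣; _∩_; Empty)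
open import Data.Product using (Σ; _×_; proj₁)
open import Data.Sum using (_⊎_)
open import Function.Definitions using (Injective)
open import Relation.Binary.PropositionalEquality using (_≡_; _≢_)

red blue : Bool
red = true
blue = false

-- A red/blue edge-colouring of a graph on vertex type V, given as a
-- symmetric colour function on pairs of vertices (only its values on
-- adjacent pairs matter).
Symmetric : {V : Set} → (V → V → Bool) → Set
Symmetric {V} c = ∀ (u v : V) → c u v ≡ c v u

MonoClique : (V : Set) → (V → V → Set) → (V → V → Bool) → Bool → ℕ → Set
MonoClique V Adj c col k =
  Σ (Fin k → V) λ f → Injective _≡_ _≡_ f ×
    (∀ i j → i ≢ j → Adj (f i) (f j) × c (f i) (f j) ≡ col)

Arrows : (V : Set) → (V → V → Set) → ℕ → ℕ → Set
Arrows V Adj a b = ∀ (c : V → V → Bool) → Symmetric c →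
  MonoClique V Adj c red a ⊎ MonoClique V Adj c blue b

CompleteArrows : ℕ → ℕ → ℕ → Set
CompleteArrows n a b = Arrows (Fin n) (λ i j → i ≢ j) a b

KVertex : ℕ → ℕ → Set
KVertex n r = Σ (Subset n) λ s → ∣ s ∣ ≡ r

KAdj : ∀ {n r} → KVertex n r → KVertex n r → Set
KAdj u v = Empty (proj₁ u ∩ proj₁ v)

KneserArrows : ℕ → ℕ → ℕ → ℕ → Set
KneserArrows n r a b = Arrows (KVertex n r) KAdj a b

IsLeast : (ℕ → Set) → ℕ → Set
IsLeast P m = P m × (∀ n → P n → m ≤ n)

IsRamseyNumber : ℕ → ℕ → ℕ → Set
IsRamseyNumber a b m = IsLeast (λ n → CompleteArrows n a b) m

IsKneserRamseyNumber : ℕ → ℕ → ℕ → ℕ → Set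
IsKneserRamseyNumber r a b m = IsLeast (λ n → KneserArrows n r a b) m

{-# OPTIONS --safe #-}
module Submission where

-- Let N = 2 R(3, t − 2) + 2 t + 1 and fix disjoint pairs v, w joined in blue
-- (if there are none, three disjoint pairs form a red triangle).  On the
-- other N − 4 points colour a pair e by 0 if e is blue to both v and w, by 1
-- if it is red to v, and by 2 if it is blue to v and red to w.  Since
-- R = R(3, t − 2) ≥ t, the Cockayne–Lorimer theorem gives R disjoint pairs of
-- colour 0, t of colour 1, or t − 1 of colour 2.  The first contain a red
-- triangle or a blue K_{t−2}, which v and w extend to a blue K_t.  In the
-- other cases the pairs are red to a common vertex, hence pairwise blue or in
-- a red triangle; the t − 1 pairs of colour 2 are completed by v.

open import Defs
open import Data.Bool using (Bool; true; false)
open import Data.Bool.Properties using (¬-not) renaming (_≟_ to _≟ᵇ_)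
open import Data.Empty using (⊥)
open import Data.Fin using (Fin; zero; suc; inject≤; quotient; remainder; combine)
open import Data.Fin.Patterns using (0F; 1F; 2F)
open import Data.Fin.Properties
  using (any?; all?; ¬∀⟶∃¬; pigeonhole; <⇒≢; _≟_; inject≤-injective; combine-remQuot)
open import Data.Fin.Subset using (Subset; ∣_∣; _∩_; _∪_; ⁅_⁆; Empty) renaming (_∈_ to _∈ₛ_)
open import Data.Fin.Subset.Properties
  using (∪-identityˡ; ∪-identityʳ; ∩-idem; ∩-comm; ∣⁅x⁆∣≡1; ∣⊥∣≡0; x∈⁅y⁆⇒x≡y; x∈p∪q⁻; x∈p∩q⁻;
         Empty-unique; nonempty?; anySubset?)
open import Data.List using (List; []; _∷_; _++_; length; lookup)
open import Data.List.Membership.DecPropositional using (_∈?_)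
open import Data.List.Membership.Propositional using (_∈_; _∉_)
open import Data.List.Membership.Propositional.Properties using (∈-++⁺ˡ; ∈-++⁺ʳ)
open import Data.List.Relation.Binary.Subset.Propositional using (_⊆_)
open import Data.List.Relation.Unary.Any using (here; there; index)
open import Data.List.Relation.Unary.Any.Properties using (lookup-index)
open import Data.Nat using (ℕ; zero; suc; _≤_; _<_; _+_; _*_; _∸_; z≤n; s≤s; s≤s⁻¹)
open import Data.Nat.Induction using (<-rec)
open import Data.Nat.Properties
  using (≤-refl; ≤-trans; ≤-reflexive; m≤n+m; m≤m+n; m<m+n; +-monoʳ-≤; +-monoˡ-≤;
         +-monoʳ-<; ≰⇒>; ≮⇒≥; module ≤-Reasoning; anyUpTo?;
         ≡-irrelevant)
  renaming (_≟_ to _≟ⁿ_)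
open import Data.Nat.Tactic.RingSolver using (solve-∀)
open import Data.Product using (Σ; ∃; ∃₂; _×_; _,_; proj₁; proj₂)
open import Data.Sum as Sum using (_⊎_; inj₁; inj₂; [_,_])
open import Data.Vec as Vec using (Vec; []; _∷_)
open import Data.Vec.Properties using (≡-dec; lookup∘tabulate)
open import Function using (_∘_; id)
open import Function.Definitions using (Injective)
open import Relation.Binary.PropositionalEquality
  using (_≡_; _≢_; refl; sym; trans; cong; cong₂; subst; subst₂)
open import Relation.Nullary
  using (¬_; Dec; yes; no; does; contradiction; ¬?; _×-dec_; _⊎-dec_; _→-dec_)
open import Relation.Nullary.Decidable using (map′; decidable-stable)

private variable
  n : ℕ

pattern #0 = here refl
pattern #1 = there (here refl)
pattern #2 = there (there (here refl))
pattern #3 = there (there (there (here refl)))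

-- Otherwise sending each point to a position in `L` would place `n` points in fewer positions, and
-- two points sharing a position are equal.
fresh : (L : List (Fin n)) → length L < n → ∃ λ x → x ∉ L
fresh {n} L |L|<n = ¬∀⟶∃¬ n (_∈ L) (λ x → _∈?_ _≟_ x L) λ all∈L →
  let i , j , i<j , same = pigeonhole |L|<n (index ∘ all∈L)
  in <⇒≢ i<j (trans (lookup-index (all∈L i))
       (trans (cong (lookup L) same) (sym (lookup-index (all∈L j)))))

-- The Cockayne–Lorimer theorem on matchings

module EdgeColouring {n : ℕ} (col : Fin n → Fin n → Fin 3) where

  -- A matching avoiding the used points L.  Repetitions in L are harmless:
  -- they only strengthen the counting hypotheses on length L.
  data Matching (i : Fin 3) : List (Fin n) → ℕ → Set where
    []   : ∀ {L} → Matching i L 0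
    edge : ∀ {L k} x y → x ≢ y → x ∉ L → y ∉ L → col x y ≡ i →
           Matching i (x ∷ y ∷ L) k → Matching i L (suc k)

  weaken : ∀ {i L L′ k} → L′ ⊆ L → Matching i L k → Matching i L′ k
  weaken L′⊆L []                         = []
  weaken L′⊆L (edge x y x≢y x∉L y∉L eq M) =
    edge x y x≢y (x∉L ∘ L′⊆L) (y∉L ∘ L′⊆L) eq (weaken ⊆′ M)
    where
    ⊆′ : x ∷ y ∷ _ ⊆ x ∷ y ∷ _
    ⊆′ (here eq)          = here eq
    ⊆′ (there (here eq))  = there (here eq)
    ⊆′ (there (there z∈)) = there (there (L′⊆L z∈))

  Joins : Fin 3 → List (Fin n) → Fin n → Fin n → Set
  Joins i L x y = x ≢ y × x ∉ L × y ∉ L × col x y ≡ i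

  -- The given matching avoids all of `T`, so it avoids `x` and `y`; the other points of `T` are
  -- given up.
  insert : ∀ {i L k x y} (T : List (Fin n)) → Joins i L x y → x ∈ T → y ∈ T →
           Matching i (T ++ L) k → Matching i L (suc k)
  insert {L = L} {x = x} {y} T (x≢y , x∉L , y∉L , eq) x∈T y∈T M =
    edge x y x≢y x∉L y∉L eq (weaken ⊆T++L M)
    where
    ⊆T++L : x ∷ y ∷ L ⊆ T ++ L
    ⊆T++L (here refl)         = ∈-++⁺ˡ x∈T
    ⊆T++L (there (here refl)) = ∈-++⁺ˡ y∈T
    ⊆T++L (there (there z∈L)) = ∈-++⁺ʳ T z∈L

  appears? : ∀ i L → Dec (∃₂ (Joins i L))
  appears? i L = any? λ x → any? λ y →
    ¬? (x ≟ y) ×-dec ¬? (_∈?_ _≟_ x L) ×-dec ¬? (_∈?_ _≟_ y L) ×-dec (col x y ≟ i)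

  -- The induction removes a small set `T` that spans an edge of every colour in play: whichever
  -- colour yields a matching outside `T`, an edge inside `T` enlarges it.
  Spanned : Fin 3 → List (Fin n) → List (Fin n) → Set
  Spanned i L T = ∃₂ λ x y → Joins i L x y × x ∈ T × y ∈ T

  insertSpanned : ∀ {i L k} T → Spanned i L T →
                  Matching i (T ++ L) k → Matching i L (suc k)
  insertSpanned T (x , y , xy , x∈T , y∈T) = insert T xy x∈T y∈T

  AllPairs : (Fin 3 → Set) → List (Fin n) → Set
  AllPairs P L = ∀ x y → x ≢ y → x ∉ L → y ∉ L → P (col x y)

  oneColour : ∀ {i} p L → length L + (p + p) ≤ n → AllPairs (_≡ i) L → Matching i L p
  oneColour zero    L _    _   = []
  oneColour (suc p) L size all =
    edge x y x≢y x∉L y∉L (all x y x≢y x∉L y∉L)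
      (oneColour p (x ∷ y ∷ L) size′
        λ u v u≢v u∉ v∉ → all u v u≢v (u∉ ∘ there ∘ there) (v∉ ∘ there ∘ there))
    where
    size′ : 2 + length L + (p + p) ≤ n
    size′ = ≤-trans (≤-reflexive (shift (length L) p)) size
      where
      shift : ∀ l p → 2 + l + (p + p) ≡ l + (suc p + suc p)
      shift = solve-∀
    2+L≤n : 2 + length L ≤ n
    2+L≤n = ≤-trans (m≤m+n _ (p + p)) size′
    x = proj₁ (fresh L (≤-trans (m≤n+m _ 1) 2+L≤n))
    x∉L = proj₂ (fresh L (≤-trans (m≤n+m _ 1) 2+L≤n))
    y = proj₁ (fresh (x ∷ L) 2+L≤n)
    y∉xL = proj₂ (fresh (x ∷ L) 2+L≤n)
    y∉L = y∉xL ∘ there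
    x≢y = λ x≡y → y∉xL (here (sym x≡y))

  -- If `ab` and `cd` have different first ends, the edge `ac` has one of the two colours and meets
  -- the given edge of the other, so three points carry both.
  cherry : ∀ {i j} L a b c d → AllPairs (λ h → h ≡ i ⊎ h ≡ j) L →
           Joins i L a b → Joins j L c d →
           ∃₂ λ x y → ∃ λ z → let T = x ∷ y ∷ z ∷ [] in Spanned i L T × Spanned j L T
  cherry L a b c d all ab@(_ , a∉ , _) cd@(_ , c∉ , _) with a ≟ c
  ... | yes refl = a , b , d , (_ , _ , ab , #0 , #1)
                             , (_ , _ , cd , #0 , #2)
  ... | no a≢c with all a c a≢c a∉ c∉
  ...   | inj₁ ac≡i = a , c , d , (_ , _ , (a≢c , a∉ , c∉ , ac≡i) , #0 , #1)
                                , (_ , _ , cd , #1 , #2)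
  ...   | inj₂ ac≡j = a , b , c , (_ , _ , ab , #0 , #1)
                                , (_ , _ , (a≢c , a∉ , c∉ , ac≡j) , #0 , #2)

  absent : ∀ {i P Q} L → AllPairs P L → ¬ ∃₂ (Joins i L) →
           (∀ h → P h → h ≡ i ⊎ Q h) → AllPairs Q L
  absent L all none split x y x≢y x∉ y∉ with split _ (all x y x≢y x∉ y∉)
  ... | inj₁ eq = contradiction (x , y , x≢y , x∉ , y∉ , eq) none
  ... | inj₂ q  = q

  -- When a colour is absent, its positive target leaves the sum; this pays for the right-hand side
  -- falling by one, from `2 + n` through `1 + n` to `n`, as the number of colours falls.
  slack : ∀ l m {s t N} → s < t → l + (m + t) ≤ suc N → l + (m + s) ≤ N
  slack l m s<t size = s≤s⁻¹ (≤-trans (+-monoʳ-< l (+-monoʳ-< m s<t)) size)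

  -- Here `m` stands for the maximum of `p` and `q`, but any upper bound serves, so it can simply
  -- drop with them. If both colours appear, a cherry costs three points and lowers `m`, `p` and `q`
  -- by one each. If one is absent, the other needs only twice its target, which is at most `m` plus
  -- the target.
  twoColours : ∀ {i j} m p q L → p ≤ m → q ≤ m → length L + (m + (p + q)) ≤ suc n →
               AllPairs (λ h → h ≡ i ⊎ h ≡ j) L → Matching i L p ⊎ Matching j L q
  twoColours _ zero    _       _ _ _ _ _ = inj₁ []
  twoColours _ (suc p) zero    _ _ _ _ _ = inj₂ []
  twoColours {i} {j} (suc m) (suc p) (suc q) L p≤m q≤m size all
    with appears? i L | appears? j L
  ... | no none | _ = inj₂ (oneColour (suc q) L
        (≤-trans (+-monoʳ-≤ (length L) (+-monoˡ-≤ (suc q) q≤m))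
          (slack (length L) (suc m) (s≤s (m≤n+m (suc q) p)) size))
        (absent {Q = _≡ j} L all none λ _ → id))
  ... | yes _ | no none = inj₁ (oneColour (suc p) L
        (≤-trans (+-monoʳ-≤ (length L) (+-monoˡ-≤ (suc p) p≤m))
          (slack (length L) (suc m) (m<m+n (suc p) (s≤s z≤n)) size))
        (absent {Q = _≡ i} L all none λ _ → Sum.swap))
  ... | yes (a , b , ab) | yes (c , d , cd) with cherry L a b c d all ab cd
  ...   | x , y , z , Ti , Tj =
    Sum.map (insertSpanned T Ti) (insertSpanned T Tj)
      (twoColours m p q (T ++ L) (s≤s⁻¹ p≤m) (s≤s⁻¹ q≤m)
        (≤-trans (≤-reflexive (shift (length L) m p q)) size)
        λ u v u≢v u∉ v∉ → all u v u≢v (u∉ ∘ ∈-++⁺ʳ T) (v∉ ∘ ∈-++⁺ʳ T))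
    where
    T = x ∷ y ∷ z ∷ []
    shift : ∀ l m p q → 3 + l + (m + (p + q)) ≡ l + (suc m + (suc p + suc q))
    shift = solve-∀

  colours : ∀ (h : Fin 3) → h ≡ 0F ⊎ h ≡ 1F ⊎ h ≡ 2F
  colours 0F = inj₁ refl
  colours 1F = inj₂ (inj₁ refl)
  colours 2F = inj₂ (inj₂ refl)

  Spans : List (Fin n) → List (Fin n) → Set
  Spans L T = Spanned 0F L T × Spanned 1F L T × Spanned 2F L T

  FourPoints : List (Fin n) → Set
  FourPoints L = ∃₂ λ w x → ∃₂ λ y z → Spans L (w ∷ x ∷ y ∷ z ∷ [])

  -- Edges of colours 0 and 1 meet at `y`. Unless `e` is `y`, the edge `ye` replaces whichever of
  -- `yu`, `yu′`, `ef` has its colour, and the three edges then lie on four points. The first two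
  -- edges are passed as functions because `col` need not be symmetric and `y` may be either end.
  centredFour : ∀ {L} y u u′ e f → y ∉ L →
    (∀ {T} → y ∈ T → u ∈ T → Spanned 0F L T) →
    (∀ {T} → y ∈ T → u′ ∈ T → Spanned 1F L T) →
    Joins 2F L e f → FourPoints L
  centredFour y u u′ e f y∉ yu yu′ ef@(_ , e∉ , _) with y ≟ e
  ... | yes refl = y , u , u′ , f , yu #0 #1 , yu′ #0 #2 , (_ , _ , ef , #0 , #3)
  ... | no y≢e with col y e in eq
  ...   | 0F = y , e , f , u′ , (_ , _ , (y≢e , y∉ , e∉ , eq) , #0 , #1) , yu′ #0 #3 , (_ , _ , ef , #1 , #2)
  ...   | 1F = y , e , f , u , yu #0 #3 , (_ , _ , (y≢e , y∉ , e∉ , eq) , #0 , #1) , (_ , _ , ef , #1 , #2)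
  ...   | 2F = y , u , u′ , e , yu #0 #1 , yu′ #0 #2 , (_ , _ , (y≢e , y∉ , e∉ , eq) , #0 , #3)

  fourPoints : ∀ {L} a b c d e f → Joins 0F L a b → Joins 1F L c d → Joins 2F L e f → FourPoints L
  fourPoints a b c d e f ab@(_ , a∉ , _) cd@(_ , c∉ , _) ef with a ≟ c
  ... | yes refl = centredFour a b d e f a∉
                     (λ y∈ u∈ → _ , _ , ab , y∈ , u∈) (λ y∈ u∈ → _ , _ , cd , y∈ , u∈) ef
  ... | no a≢c with col a c in eq
  ...   | 0F = centredFour c a d e f c∉
                 (λ y∈ u∈ → _ , _ , (a≢c , a∉ , c∉ , eq) , u∈ , y∈) (λ y∈ u∈ → _ , _ , cd , y∈ , u∈) ef
  ...   | 1F = centredFour a b c e f a∉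
                 (λ y∈ u∈ → _ , _ , ab , y∈ , u∈) (λ y∈ u∈ → _ , _ , (a≢c , a∉ , c∉ , eq) , y∈ , u∈) ef
  ...   | 2F = a , b , c , d , (_ , _ , ab , #0 , #1) , (_ , _ , cd , #2 , #3)
                 , (_ , _ , (a≢c , a∉ , c∉ , eq) , #0 , #2)

  -- If all three colours appear, then some four points carry all three, and
  -- removing them lowers each of m, p, q and r by one; otherwise two colours remain.
  threeColours : ∀ m p q r L → p ≤ m → q ≤ m → r ≤ m →
    length L + (m + (p + (q + r))) ≤ 2 + n →
    Matching 0F L p ⊎ Matching 1F L q ⊎ Matching 2F L r
  threeColours _ zero    _       _       _ _ _ _ _ = inj₁ []
  threeColours _ (suc p) zero    _       _ _ _ _ _ = inj₂ (inj₁ [])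
  threeColours _ (suc p) (suc q) zero    _ _ _ _ _ = inj₂ (inj₂ [])
  threeColours (suc m) (suc p) (suc q) (suc r) L p≤m q≤m r≤m size
    with appears? 0F L | appears? 1F L | appears? 2F L
  ... | no none | _ | _ =
    inj₂ (twoColours (suc m) (suc q) (suc r) L q≤m r≤m
      (slack (length L) (suc m) (s≤s (m≤n+m _ p)) size)
      (absent {Q = λ h → h ≡ 1F ⊎ h ≡ 2F} L (λ x y _ _ _ → colours (col x y)) none λ _ → id))
  ... | yes _ | no none | _ =
    [ inj₁ , inj₂ ∘ inj₂ ] (twoColours (suc m) (suc p) (suc r) L p≤m r≤m
      (slack (length L) (suc m) (+-monoʳ-< (suc p) (s≤s (m≤n+m _ q))) size)
      (absent {Q = λ h → h ≡ 0F ⊎ h ≡ 2F} L (λ x y _ _ _ → colours (col x y)) none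
        λ _ → [ inj₂ ∘ inj₁ , [ inj₁ , inj₂ ∘ inj₂ ] ]))
  ... | yes _ | yes _ | no none =
    [ inj₁ , inj₂ ∘ inj₁ ] (twoColours (suc m) (suc p) (suc q) L p≤m q≤m
      (slack (length L) (suc m) (+-monoʳ-< (suc p) (m<m+n (suc q) (s≤s z≤n))) size)
      (absent {Q = λ h → h ≡ 0F ⊎ h ≡ 1F} L (λ x y _ _ _ → colours (col x y)) none
        λ _ → [ inj₂ ∘ inj₁ , [ inj₂ ∘ inj₂ , inj₁ ] ]))
  ... | yes (a , b , ab) | yes (c , d , cd) | yes (e , f , ef)
    with fourPoints a b c d e f ab cd ef
  ...   | w , x , y , z , T₀ , T₁ , T₂ =
    Sum.map (insertSpanned T T₀) (Sum.map (insertSpanned T T₁) (insertSpanned T T₂))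
      (threeColours m p q r (T ++ L) (s≤s⁻¹ p≤m) (s≤s⁻¹ q≤m) (s≤s⁻¹ r≤m)
        (≤-trans (≤-reflexive (shift (length L) m p q r)) size))
    where
    T = w ∷ x ∷ y ∷ z ∷ []
    shift : ∀ l m p q r → 4 + l + (m + (p + (q + r))) ≡ l + (suc m + (suc p + (suc q + suc r)))
    shift = solve-∀

-- Kneser graphs of pairs

pair : Fin n → Fin n → Subset n
pair x y = ⁅ x ⁆ ∪ ⁅ y ⁆

∣pair∣≡2 : {x y : Fin n} → x ≢ y → ∣ pair x y ∣ ≡ 2
∣pair∣≡2 {x = zero}  {zero}  x≢y = contradiction refl x≢y
∣pair∣≡2 {x = zero}  {suc y} x≢y = cong suc (trans (cong ∣_∣ (∪-identityˡ ⁅ y ⁆)) (∣⁅x⁆∣≡1 y))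
∣pair∣≡2 {x = suc x} {zero}  x≢y = cong suc (trans (cong ∣_∣ (∪-identityʳ ⁅ x ⁆)) (∣⁅x⁆∣≡1 x))
∣pair∣≡2 {x = suc x} {suc y} x≢y = ∣pair∣≡2 (x≢y ∘ cong suc)

vertex : (x y : Fin n) → x ≢ y → KVertex n 2
vertex x y x≢y = pair x y , ∣pair∣≡2 x≢y

_∈ᵥ_ : Fin n → KVertex n 2 → Set
z ∈ᵥ v = z ∈ₛ proj₁ v

∈-vertex : {x y z : Fin n} (x≢y : x ≢ y) → z ∈ᵥ vertex x y x≢y → z ≡ x ⊎ z ≡ y
∈-vertex {x = x} {y} x≢y z∈ = Sum.map (x∈⁅y⁆⇒x≡y x) (x∈⁅y⁆⇒x≡y y) (x∈p∪q⁻ ⁅ x ⁆ ⁅ y ⁆ z∈)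

both : (P : Fin n → Set) {x y z : Fin n} → P x → P y → z ≡ x ⊎ z ≡ y → P z
both P px py (inj₁ refl) = px
both P px py (inj₂ refl) = py

vertex⊆ : ∀ {x y z : Fin n} {L} (x≢y : x ≢ y) → x ∈ L → y ∈ L → z ∈ᵥ vertex x y x≢y → z ∈ L
vertex⊆ {L = L} x≢y x∈L y∈L = both (_∈ L) x∈L y∈L ∘ ∈-vertex x≢y

vertex-avoids : ∀ {x y z : Fin n} {L} (x≢y : x ≢ y) → x ∉ L → y ∉ L → z ∈ᵥ vertex x y x≢y → z ∉ L
vertex-avoids {L = L} x≢y x∉L y∉L = both (_∉ L) x∉L y∉L ∘ ∈-vertex x≢y

-- Made total by the junk value v at x ≡ y.
vertexOr : KVertex n 2 → Fin n → Fin n → KVertex n 2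
vertexOr v x y with x ≟ y
... | yes _   = v
... | no x≢y = vertex x y x≢y

∈-vertexOr : ∀ v {x y z : Fin n} → x ≢ y → z ∈ᵥ vertexOr v x y → z ≡ x ⊎ z ≡ y
∈-vertexOr v {x} {y} x≢y z∈ with x ≟ y
... | yes x≡y = contradiction x≡y x≢y
... | no x≢y′ = ∈-vertex x≢y′ z∈

KAdj-irrefl : (v : KVertex n 2) → ¬ KAdj v v
KAdj-irrefl {n} (s , ∣s∣≡2) adj with Empty-unique (subst Empty (∩-idem s) adj)
... | refl with () ← trans (sym ∣s∣≡2) (∣⊥∣≡0 n)

disjoint⇒KAdj : (u v : KVertex n 2) → (∀ {z} → z ∈ᵥ u → z ∈ᵥ v → ⊥) → KAdj u v
disjoint⇒KAdj u v disj (z , z∈) =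
  let z∈u , z∈v = x∈p∩q⁻ (proj₁ u) (proj₁ v) z∈ in disj z∈u z∈v

KAdj-sym : {u v : KVertex n 2} → KAdj u v → KAdj v u
KAdj-sym {u = u} {v} = subst Empty (∩-comm (proj₁ u) (proj₁ v))

avoid⇒KAdj : ∀ {L} (u v : KVertex n 2) → (∀ {z} → z ∈ᵥ u → z ∈ L) → (∀ {z} → z ∈ᵥ v → z ∉ L) → KAdj u v
avoid⇒KAdj u v u⊆L v∩L=∅ = disjoint⇒KAdj u v λ z∈u z∈v → v∩L=∅ z∈v (u⊆L z∈u)

-- The field `avoids` has two uses: it makes a new pair disjoint from the earlier ones while the
-- family is built, and later it makes all members adjacent to the vertices whose points are listed
-- in `L`.
record Family {n : ℕ} (Q : KVertex n 2 → Set) (L : List (Fin n)) (k : ℕ) : Set where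
  field
    member : Fin k → KVertex n 2
    adj    : ∀ i j → i ≢ j → KAdj (member i) (member j)
    avoids : ∀ i {z} → z ∈ᵥ member i → z ∉ L
    holds  : ∀ i → Q (member i)

module _ {n : ℕ} (K : KVertex n 2 → Fin 3) (v₀ : KVertex n 2) where

  open EdgeColouring (λ x y → K (vertexOr v₀ x y))

  family : ∀ {h L k} → Matching h L k → Family (λ u → K u ≡ h) L k
  family [] = record { member = λ () ; adj = λ () ; avoids = λ () ; holds = λ () }
  family {L = L} (edge x y x≢y x∉L y∉L eq M) = record
    { member = member ; adj = adj ; avoids = avoids ; holds = holds }
    where
    module F = Family (family M)
    -- With `vertexOr` kept as the member, `holds` is the colour equation of the edge itself; `x≢y`
    -- excludes the junk value.
    u = vertexOr v₀ x y

    member : Fin (suc _) → KVertex n 2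
    member zero    = u
    member (suc i) = F.member i

    u⊆ : ∀ {z} → z ∈ᵥ u → z ∈ x ∷ y ∷ L
    u⊆ = both (_∈ x ∷ y ∷ L) #0 #1 ∘ ∈-vertexOr v₀ x≢y

    adj₀ : ∀ i → KAdj u (F.member i)
    adj₀ i = avoid⇒KAdj u (F.member i) u⊆ (F.avoids i)

    adj : ∀ i j → i ≢ j → KAdj (member i) (member j)
    adj zero    zero    i≢j = contradiction refl i≢j
    adj zero    (suc j) i≢j = adj₀ j
    adj (suc i) zero    i≢j = KAdj-sym {u = u} {F.member i} (adj₀ i)
    adj (suc i) (suc j) i≢j = F.adj i j (i≢j ∘ cong suc)

    avoids : ∀ i {z} → z ∈ᵥ member i → z ∉ L
    avoids zero    z∈ = both (_∉ L) x∉L y∉L (∈-vertexOr v₀ x≢y z∈)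
    avoids (suc i) z∈ = F.avoids i z∈ ∘ there ∘ there

    holds : ∀ i → K (member i) ≡ _
    holds zero    = eq
    holds (suc i) = F.holds i

-- Cliques in a coloured Kneser graph of pairs

module KneserColouring {n : ℕ} (c : KVertex n 2 → KVertex n 2 → Bool) (c-sym : Symmetric c) where

  private
    V = KVertex n 2

  Clique : Bool → ℕ → Set
  Clique = MonoClique V KAdj c

  -- Injectivity comes for free: equal values at distinct indices would make a two-element set
  -- disjoint from itself.
  clique : ∀ {h k} (f : Fin k → V) →
           (∀ i j → i ≢ j → KAdj (f i) (f j) × c (f i) (f j) ≡ h) → Clique h k
  clique f mono = f , injective , mono
    where
    injective : Injective _≡_ _≡_ f
    injective {i} {j} fi≡fj = decidable-stable (i ≟ j) λ i≢j →
      KAdj-irrefl (f i) (subst (KAdj (f i)) (sym fi≡fj) (proj₁ (mono i j i≢j)))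

  cons : ∀ {h k} v (C : Clique h k) →
         (∀ i → KAdj v (proj₁ C i) × c v (proj₁ C i) ≡ h) → Clique h (suc k)
  cons {h} {k} v (f , _ , mono) joined = clique g mono′
    where
    g : Fin (suc k) → V
    g zero    = v
    g (suc i) = f i

    mono′ : ∀ i j → i ≢ j → KAdj (g i) (g j) × c (g i) (g j) ≡ h
    mono′ zero    zero    i≢j = contradiction refl i≢j
    mono′ zero    (suc j) i≢j = joined j
    mono′ (suc i) zero    i≢j =
      KAdj-sym {u = v} {f i} (proj₁ (joined i)) , trans (c-sym (f i) v) (proj₂ (joined i))
    mono′ (suc i) (suc j) i≢j = mono i j (i≢j ∘ cong suc)

  triangle : ∀ {h} u v w → KAdj u v → KAdj u w → KAdj v w →
             c u v ≡ h → c u w ≡ h → c v w ≡ h → Clique h 3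
  triangle u v w uv uw vw uv≡h uw≡h vw≡h =
    cons u (cons v (cons w (clique {k = 0} (λ ()) λ ()) λ ())
      λ { zero → vw , vw≡h })
      λ { zero → uv , uv≡h ; (suc zero) → uw , uw≡h }

  -- A red edge between two red neighbours of `v` closes a red triangle. The blue outcome records
  -- that its vertices are those of `f`, so that a further vertex can be joined to it.
  redNeighbours : ∀ {k} v (f : Fin k → V) → (∀ i → KAdj v (f i) × c v (f i) ≡ red) →
                  (∀ i j → i ≢ j → KAdj (f i) (f j)) →
                  Clique red 3 ⊎ Σ (Clique blue k) λ C → ∀ i → proj₁ C i ≡ f i
  redNeighbours v f vf adj with any? (λ i → any? λ j → ¬? (i ≟ j) ×-dec (c (f i) (f j) ≟ᵇ red))
  ... | yes (i , j , i≢j , ij-red) = inj₁ (triangle v (f i) (f j)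
          (proj₁ (vf i)) (proj₁ (vf j)) (adj i j i≢j) (proj₂ (vf i)) (proj₂ (vf j)) ij-red)
  ... | no none = inj₂ (clique f (λ i j i≢j → adj i j i≢j , ¬-not λ eq → none (i , j , i≢j , eq)) , λ _ → refl)

  -- Redness to the first vertex is tested first, so colour 2 implies blueness to it; hence colour 2
  -- needs one pair fewer than colour 1.
  classify : Bool → Bool → Fin 3
  classify true  _     = 1F
  classify false true  = 2F
  classify false false = 0F

  classify-0 : ∀ p q → classify p q ≡ 0F → p ≡ blue × q ≡ blue
  classify-0 false false _ = refl , refl
  classify-0 false true ()

  classify-1 : ∀ p q → classify p q ≡ 1F → p ≡ red
  classify-1 true _ _ = refl
  classify-1 false true ()
  classify-1 false false ()

  classify-2 : ∀ p q → classify p q ≡ 2F → p ≡ blue × q ≡ red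
  classify-2 false true  _ = refl , refl
  classify-2 false false ()

  -- Extending a blue edge to a blue clique

  module _ {R s : ℕ} (arrows : CompleteArrows R 3 s) (2+s≤R : 2 + s ≤ R)
           (size : 2 * R + 2 * (2 + s) + 1 ≤ n) where

    fromBluePair : (L : List (Fin n)) → length L ≡ 4 → (v w : V) →
      (∀ {z} → z ∈ᵥ v → z ∈ L) → (∀ {z} → z ∈ᵥ w → z ∈ L) →
      KAdj v w → c v w ≡ blue → Clique red 3 ⊎ Clique blue (2 + s)
    fromBluePair L ∣L∣≡4 v w v⊆L w⊆L vw vw-blue =
      [ blueToBoth ∘ family K v , [ redToFirst ∘ family K v , redToSecond ∘ family K v ] ]
        (threeColours R R (2 + s) (1 + s) L ≤-refl 2+s≤R (≤-trans (m≤n+m _ 1) 2+s≤R) room)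
      where
      K : V → Fin 3
      K u = classify (c v u) (c w u)

      open EdgeColouring (λ x y → K (vertexOr v x y))

      -- With `t = 2 + s`, the four points of `L` and the targets `R`, `t`, `t − 1` with maximum `R`
      -- use the hypothesis of `threeColours` with equality when `n` is the bound of the theorem.
      count : ∀ R s → 4 + (R + (R + ((2 + s) + (1 + s)))) ≡ 2 + (2 * R + 2 * (2 + s) + 1)
      count = solve-∀

      room : length L + (R + (R + ((2 + s) + (1 + s)))) ≤ 2 + n
      room rewrite ∣L∣≡4 = ≤-trans (≤-reflexive (count R s)) (s≤s (s≤s size))

      blueToBoth : Family (λ u → K u ≡ 0F) L R → Clique red 3 ⊎ Clique blue (2 + s)
      -- The complete graph on the indices of the family is coloured through `member`; distinct
      -- indices give disjoint pairs, so its cliques become Kneser cliques.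
      blueToBoth F with arrows (λ i j → c (member i) (member j)) (λ i j → c-sym _ _)
        where open Family F
      ... | inj₁ (g , _ , mono) = inj₁ (clique (member ∘ g) λ i j i≢j →
              adj _ _ (proj₁ (mono i j i≢j)) , proj₂ (mono i j i≢j))
        where open Family F
      ... | inj₂ (g , _ , mono) = inj₂
              (cons v (cons w (clique (member ∘ g) λ i j i≢j →
                  adj _ _ (proj₁ (mono i j i≢j)) , proj₂ (mono i j i≢j))
                λ i → avoid⇒KAdj w (member (g i)) w⊆L (avoids (g i)) , proj₂ (blues (g i)))
                λ { zero    → vw , vw-blue
                  ; (suc i) → avoid⇒KAdj v (member (g i)) v⊆L (avoids (g i)) , proj₁ (blues (g i)) })
        where
        open Family F
        blues : ∀ i → c v (member i) ≡ blue × c w (member i) ≡ blue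
        blues i = classify-0 _ _ (holds i)

      redToFirst : Family (λ u → K u ≡ 1F) L (2 + s) → Clique red 3 ⊎ Clique blue (2 + s)
      redToFirst F = Sum.map₂ proj₁ (redNeighbours v member
          (λ i → avoid⇒KAdj v (member i) v⊆L (avoids i) , classify-1 _ _ (holds i)) adj)
        where open Family F

      redToSecond : Family (λ u → K u ≡ 2F) L (1 + s) → Clique red 3 ⊎ Clique blue (2 + s)
      redToSecond F = Sum.map₂ addFirst (redNeighbours w member
          (λ i → avoid⇒KAdj w (member i) w⊆L (avoids i) , proj₂ (classify-2 _ _ (holds i))) adj)
        where
        open Family F
        addFirst : (Σ (Clique blue (1 + s)) λ C → ∀ i → proj₁ C i ≡ member i) → Clique blue (2 + s)
        addFirst (C , C≗) = cons v C λ i → subst (λ u → KAdj v u × c v u ≡ blue) (sym (C≗ i))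
          (avoid⇒KAdj v (member i) v⊆L (avoids i) , proj₁ (classify-2 _ _ (holds i)))

    6≤n : 6 ≤ n
    6≤n = begin
      2 + 4                         ≤⟨ +-monoˡ-≤ 4 (m≤m+n 2 s) ⟩
      (2 + s) + 4                   ≤⟨ +-monoˡ-≤ 4 2+s≤R ⟩
      R + 4                         ≤⟨ +-monoˡ-≤ 4 (m≤m+n R (R + (2 * s + 1))) ⟩
      R + (R + (2 * s + 1)) + 4     ≡⟨ shape R s ⟩
      2 * R + 2 * (2 + s) + 1       ≤⟨ size ⟩
      n                             ∎
      where
      open ≤-Reasoning
      shape : ∀ R s → R + (R + (2 * s + 1)) + 4 ≡ 2 * R + 2 * (2 + s) + 1
      shape = solve-∀

    -- Under a constant colouring, `oneColour` just picks disjoint pairs; six points give three.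
    module Plain = EdgeColouring {n} (λ _ _ → 0F)

    fromThreePairs : Plain.Matching 0F [] 3 → Clique red 3 ⊎ Clique blue (2 + s)
    fromThreePairs (Plain.edge a b a≢b _ _ _ (Plain.edge x y x≢y x∉ y∉ _
                     (Plain.edge p q p≢q p∉ q∉ _ Plain.[]))) =
      byColours _ _ _ refl refl refl
      where
      u₁ = vertex a b a≢b
      u₂ = vertex x y x≢y
      u₃ = vertex p q p≢q

      L₁₂ = x ∷ y ∷ a ∷ b ∷ []

      u₁₂ : KAdj u₁ u₂
      u₁₂ = avoid⇒KAdj u₁ u₂ (vertex⊆ {L = a ∷ b ∷ []} a≢b #0 #1) (vertex-avoids x≢y x∉ y∉)
      u₁₃ : KAdj u₁ u₃
      u₁₃ = avoid⇒KAdj u₁ u₃ (vertex⊆ {L = L₁₂} a≢b #2 #3) (vertex-avoids p≢q p∉ q∉)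
      u₂₃ : KAdj u₂ u₃
      u₂₃ = avoid⇒KAdj u₂ u₃ (vertex⊆ {L = L₁₂} x≢y #0 #1) (vertex-avoids p≢q p∉ q∉)

      byColours : ∀ h₁₂ h₁₃ h₂₃ → c u₁ u₂ ≡ h₁₂ → c u₁ u₃ ≡ h₁₃ → c u₂ u₃ ≡ h₂₃ →
                  Clique red 3 ⊎ Clique blue (2 + s)
      byColours true true true c₁₂ c₁₃ c₂₃ =
        inj₁ (triangle u₁ u₂ u₃ u₁₂ u₁₃ u₂₃ c₁₂ c₁₃ c₂₃)
      byColours false _ _ c₁₂ _ _ =
        fromBluePair (a ∷ b ∷ x ∷ y ∷ []) refl u₁ u₂
          (vertex⊆ a≢b #0 #1) (vertex⊆ x≢y #2 #3) u₁₂ c₁₂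
      byColours true false _ _ c₁₃ _ =
        fromBluePair (a ∷ b ∷ p ∷ q ∷ []) refl u₁ u₃
          (vertex⊆ a≢b #0 #1) (vertex⊆ p≢q #2 #3) u₁₃ c₁₃
      byColours true true false _ _ c₂₃ =
        fromBluePair (x ∷ y ∷ p ∷ q ∷ []) refl u₂ u₃
          (vertex⊆ x≢y #0 #1) (vertex⊆ p≢q #2 #3) u₂₃ c₂₃

    kneserClique : Clique red 3 ⊎ Clique blue (2 + s)
    kneserClique = fromThreePairs
      (Plain.oneColour 3 [] 6≤n (λ _ _ _ _ _ → refl))

-- The bound 2 (b − 1) < R(3, b)

module _ (m : ℕ) {R : ℕ} (R≤m*2 : R ≤ m * 2) where

  private
    quot : Fin R → Fin m
    quot i = quotient 2 (inject≤ i R≤m*2)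

    rem : Fin R → Fin 2
    rem i = remainder {m} 2 (inject≤ i R≤m*2)

    quot-rem-injective : ∀ {i j} → quot i ≡ quot j → rem i ≡ rem j → i ≡ j
    quot-rem-injective {i} {j} q≡ r≡ = inject≤-injective R≤m*2 R≤m*2 i j
      (trans (sym (combine-remQuot {m} 2 _)) (trans (cong₂ combine q≡ r≡) (combine-remQuot {m} 2 _)))

  -- Red joins i and j when ⌊i/2⌋ = ⌊j/2⌋, so the red graph is a matching.
  halves-avoid : ¬ CompleteArrows R 3 (suc m)
  halves-avoid arrows with arrows (λ i j → does (quot i ≟ quot j)) sym-does
    where
    sym-does : Symmetric (λ i j → does (quot i ≟ quot j))
    sym-does i j with quot i ≟ quot j | quot j ≟ quot i
    ... | yes _ | yes _ = refl
    ... | no _  | no _  = refl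
    ... | yes e | no ¬e = contradiction (sym e) ¬e
    ... | no ¬e | yes e = contradiction (sym e) ¬e
  -- Two of the three corners share a remainder modulo 2, and redness gives them the same quotient,
  -- so they coincide.
  ... | inj₁ (f , f-inj , mono) =
    let i , j , i<j , same = pigeonhole ≤-refl (rem ∘ f)
        i≢j = <⇒≢ i<j
    in i≢j (f-inj (quot-rem-injective (red⇒≡ (f i) (f j) (proj₂ (mono i j i≢j))) same))
    where
    red⇒≡ : ∀ i j → does (quot i ≟ quot j) ≡ red → quot i ≡ quot j
    red⇒≡ i j eq with quot i ≟ quot j
    ... | yes e = e
    red⇒≡ i j () | no _
  -- There are only `m` quotients for `suc m` vertices, so two of them are joined in red.
  ... | inj₂ (f , f-inj , mono) =
    let i , j , i<j , same = pigeonhole ≤-refl (quot ∘ f)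
    in blue⇒≢ (f i) (f j) (proj₂ (mono i j (<⇒≢ i<j))) same
    where
    blue⇒≢ : ∀ i j → does (quot i ≟ quot j) ≡ blue → quot i ≢ quot j
    blue⇒≢ i j eq with quot i ≟ quot j
    ... | no ¬e = ¬e
    blue⇒≢ i j () | yes _

-- The bound gives `R ≥ 2 (s − 1) + 1 = 2 s − 1`, which is at least `s + 2` exactly when `s ≥ 3`.
-- This is where `t ≥ 5` enters.
arrows⇒2+s≤R : ∀ {R} s → 3 ≤ s → CompleteArrows R 3 s → 2 + s ≤ R
arrows⇒2+s≤R {R} (suc (suc (suc u))) (s≤s (s≤s (s≤s _))) arrows =
  ≤-trans (m≤m+n (5 + u) u) (≤-trans (≤-reflexive (shape u)) (≰⇒> λ R≤ → halves-avoid (2 + u) R≤ arrows))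
  where
  shape : ∀ u → 5 + u + u ≡ suc ((2 + u) * 2)
  shape = solve-∀

-- Deciding arrow relations by exhaustive search

Searchable : Set → Set₁
Searchable A = ∀ {P : A → Set} → (∀ a → Dec (P a)) → Dec (Σ A P)

private variable
  A B : Set

-- A universal statement is the absence of a counterexample, and decidability of `P` removes the
-- double negation.
search-∀ : Searchable A → {P : A → Set} → (∀ a → Dec (P a)) → Dec (∀ a → P a)
search-∀ search P? = map′
  (λ none a → decidable-stable (P? a) λ ¬p → none (a , ¬p))
  (λ all (a , ¬p) → ¬p (all a))
  (¬? (search λ a → ¬? (P? a)))

search-Bool : Searchable Bool
search-Bool P? = map′
  [ (true ,_) , (false ,_) ]
  (λ { (true , p) → inj₁ p ; (false , p) → inj₂ p })
  (P? true ⊎-dec P? false)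

search-× : Searchable A → Searchable B → Searchable (A × B)
search-× searchA searchB P? = map′
  (λ (a , b , p) → (a , b) , p)
  (λ ((a , b) , p) → a , b , p)
  (searchA λ a → searchB λ b → P? (a , b))

search-Vec : Searchable A → ∀ k → Searchable (Vec A k)
search-Vec search zero    P? = map′ ([] ,_) (λ { ([] , p) → p }) (P? [])
search-Vec search (suc k) P? = map′
  (λ (a , as , p) → a ∷ as , p)
  (λ { (a ∷ as , p) → a , as , p })
  (search λ a → search-Vec search k λ as → P? (a ∷ as))

-- Proofs of a cardinality equation are all equal, so each subset of the right size underlies a
-- single vertex and it suffices to search the subsets.
search-KVertex : ∀ n r → Searchable (KVertex n r)
search-KVertex n r {P} P? = map′
  (λ (s , e , p) → (s , e) , p)
  (λ ((s , e) , p) → s , e , p)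
  (anySubset? λ s → search-≡ s (∣ s ∣ ≟ⁿ r))
  where
  search-≡ : ∀ s → Dec (∣ s ∣ ≡ r) → Dec (Σ (∣ s ∣ ≡ r) λ e → P (s , e))
  search-≡ s (no ¬e) = no (¬e ∘ proj₁)
  search-≡ s (yes e) = map′ (e ,_) (λ (e′ , p) → subst (λ e → P (s , e)) (≡-irrelevant e′ e) p) (P? (s , e))

_≟ᵛ_ : ∀ {n r} (u v : KVertex n r) → Dec (u ≡ v)
(s , e) ≟ᵛ (s′ , e′) with ≡-dec _≟ᵇ_ s s′
... | no s≢s′ = no (s≢s′ ∘ cong proj₁)
... | yes refl = yes (cong (s ,_) (≡-irrelevant e e′))

-- A function on subsets stored as a binary tree: without function
-- extensionality the functions themselves cannot be searched.
Table : ℕ → Set → Set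
Table zero    A = A
Table (suc n) A = Table n A × Table n A

at : Table n A → Subset n → A
at T         []          = T
at (T₁ , T₂) (true ∷ s)  = at T₁ s
at (T₁ , T₂) (false ∷ s) = at T₂ s

table : ∀ n → (Subset n → A) → Table n A
table zero    f = f []
table (suc n) f = table n (f ∘ (true ∷_)) , table n (f ∘ (false ∷_))

at-table : (f : Subset n → A) → ∀ s → at (table n f) s ≡ f s
at-table f []          = refl
at-table f (true ∷ s)  = at-table (f ∘ (true ∷_)) s
at-table f (false ∷ s) = at-table (f ∘ (false ∷_)) s

search-Table : ∀ n → Searchable A → Searchable (Table n A)
search-Table zero    search = search
search-Table (suc n) search = search-× (search-Table n search) (search-Table n search)

MonoClique-resp : ∀ {V Adj c c′ h k} → (∀ u v → c u v ≡ c′ u v) →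
                  MonoClique V Adj c h k → MonoClique V Adj c′ h k
MonoClique-resp c≗c′ (f , f-inj , mono) = f , f-inj , λ i j i≢j →
  proj₁ (mono i j i≢j) , trans (sym (c≗c′ (f i) (f j))) (proj₂ (mono i j i≢j))

monoClique? : ∀ {n r} c h k → Dec (MonoClique (KVertex n r) KAdj c h k)
monoClique? {n} {r} c h k = map′ fromVec toVec
  (search-Vec (search-KVertex n r) k λ us → all? λ i → all? λ j → good? us i j)
  where
  V = KVertex n r
  -- The condition speaks of two values instead of the whole map, so it transports along
  -- `lookup∘tabulate` without function extensionality.
  Good : V → V → Fin k → Fin k → Set
  Good u v i j = (u ≡ v → i ≡ j) × (i ≢ j → KAdj u v × c u v ≡ h)

  good? : ∀ us i j → Dec (Good (Vec.lookup us i) (Vec.lookup us j) i j)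
  good? us i j = ((u ≟ᵛ v) →-dec (i ≟ j)) ×-dec
    (¬? (i ≟ j) →-dec (¬? (nonempty? (proj₁ u ∩ proj₁ v)) ×-dec (c u v ≟ᵇ h)))
    where
    u = Vec.lookup us i
    v = Vec.lookup us j

  fromVec : (Σ (Vec V k) λ us → ∀ i j → Good (Vec.lookup us i) (Vec.lookup us j) i j) →
            MonoClique V KAdj c h k
  fromVec (us , good) = Vec.lookup us , (λ {i} {j} → proj₁ (good i j)) , λ i j → proj₂ (good i j)

  toVec : MonoClique V KAdj c h k →
          Σ (Vec V k) λ us → ∀ i j → Good (Vec.lookup us i) (Vec.lookup us j) i j
  toVec (f , f-inj , mono) = Vec.tabulate f , λ i j →
    subst₂ (λ u v → Good u v i j) (sym (lookup∘tabulate f i)) (sym (lookup∘tabulate f j))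
      (f-inj , mono i j)

-- Every colouring agrees pointwise with one read off a table of tables, and monochromatic cliques
-- depend only on the pointwise values, so testing the finitely many tables decides the relation.
kneserArrows? : ∀ n r a b → Dec (KneserArrows n r a b)
kneserArrows? n r a b = map′ fromTables toTables
  (search-∀ (search-Table n (search-Table n search-Bool)) λ T →
    symmetric? (colouring T) →-dec
      (monoClique? (colouring T) red a ⊎-dec monoClique? (colouring T) blue b))
  where
  V = KVertex n r

  colouring : Table n (Table n Bool) → V → V → Bool
  colouring T u v = at (at T (proj₁ u)) (proj₁ v)

  Arrow : (V → V → Bool) → Set
  Arrow c = Symmetric c → MonoClique V KAdj c red a ⊎ MonoClique V KAdj c blue b

  symmetric? : ∀ c → Dec (Symmetric {V} c)
  symmetric? c = search-∀ (search-KVertex n r) λ u → search-∀ (search-KVertex n r) λ v → c u v ≟ᵇ c v u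

  toTables : KneserArrows n r a b → ∀ T → Arrow (colouring T)
  toTables arrows T = arrows (colouring T)

  -- Tables are indexed by all subsets; those of size other than `r` receive the default `d`, which
  -- no vertex ever reads.
  extendBy : Bool → (V → Bool) → Subset n → Bool
  extendBy d f s with ∣ s ∣ ≟ⁿ r
  ... | yes e = f (s , e)
  ... | no _  = d

  extendBy-KVertex : ∀ d f (u : V) → extendBy d f (proj₁ u) ≡ f u
  extendBy-KVertex d f (s , e) with ∣ s ∣ ≟ⁿ r
  ... | yes e′ = cong (λ e → f (s , e)) (≡-irrelevant e′ e)
  ... | no ¬e  = contradiction e ¬e

  fromTables : (∀ T → Arrow (colouring T)) → KneserArrows n r a b
  fromTables arrows c c-sym = Sum.map (MonoClique-resp {Adj = KAdj} agree) (MonoClique-resp {Adj = KAdj} agree)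
    (arrows T λ u v → trans (agree u v) (trans (c-sym u v) (sym (agree v u))))
    where
    T = table n λ s → table n λ s′ → extendBy red (λ u → extendBy red (c u) s′) s

    agree : ∀ u v → colouring T u v ≡ c u v
    agree u v = trans (cong (λ T′ → at T′ (proj₁ v)) (at-table _ (proj₁ u)))
      (trans (at-table _ (proj₁ v))
      (trans (extendBy-KVertex red _ u) (extendBy-KVertex red (c u) v)))

-- Existence of the Kneser Ramsey number and its bound

least : {P : ℕ → Set} → (∀ n → Dec (P n)) → ∀ n → P n → ∃ (IsLeast P)
least {P} P? = <-rec _ λ n smaller p → choose n smaller p (anyUpTo? P? n)
  where
  choose : ∀ n → (∀ {m} → m < n → P m → ∃ (IsLeast P)) → P n →
           Dec (∃ λ m → m < n × P m) → ∃ (IsLeast P)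
  -- A smaller witness is handed to the induction hypothesis; if there is none, `n` itself is least.
  choose n smaller p (yes (m , m<n , pm)) = smaller m<n pm
  choose n smaller p (no none)            = n , p , λ m pm → ≮⇒≥ λ m<n → none (m , m<n , pm)

theorem1p9 : ∀ (t : ℕ) → 5 ≤ t → ∀ (R : ℕ) → IsRamseyNumber 3 (t ∸ 2) R →
    Σ ℕ λ K → IsKneserRamseyNumber 2 3 t K × K ≤ 2 * R + 2 * t + 1
theorem1p9 (suc (suc s)) (s≤s (s≤s 3≤s)) R (arrows , _) =
  -- The arrow relation at `N` serves twice: it starts the search for the least value, and
  -- minimality applied to it bounds that value by `N`.
  let K , isLeast = least (λ n → kneserArrows? n 2 3 (2 + s)) N N-arrows
  in K , isLeast , proj₂ isLeast N N-arrows
  where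
  N = 2 * R + 2 * (2 + s) + 1

  N-arrows : KneserArrows N 2 3 (2 + s)
  N-arrows c c-sym =
    KneserColouring.kneserClique c c-sym arrows (arrows⇒2+s≤R s 3≤s arrows) ≤-refl
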